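{- Let $X=\bigcup_{n\ge1}X_n$ be a positively graded set. The space $K[\mathcal K_\infty,X]=\bigoplus_{n\ge1}K[\mathcal K_{n,X}]$ with the operations $\bullet_i$ described in the context is a preshuffle algebra, and it is the free preshuffle algebra on $X$: for every preshuffle algebra $A$ and every map $\varphi:X\to A$ with $\varphi(X_n)\subseteq A_n$, there is a unique degree-preserving linear map $\Phi:K[\mathcal K_\infty,X]\to A$ with $\Phi(u\bullet_iv)=\Phi(u)\bullet_i\Phi(v)$ for all $u,v,i$ and $\Phi(\xi_n;x)=\varphi(x)$ for $x\in X_n$.
   Context: A preshuffle algebra is a graded vector space $A=\bigoplus_{n\ge0}A_n$ over a field $K$ with linear maps $\bullet_i:A_n\otimes A_m\to A_{n+m}$ for all $n,m\ge0$ and $0\le i\le m$, such that $(x\bullet_iy)\bullet_jz=x\bullet_{i+j}(y\bullet_jz)$ for all homogeneous $x,y,z$, $0\le i\le|y|$, $0\le j\le|z|$ ($|\cdot|$ denotes degree). $\mathcal K_n$ is the set of surjective maps $f:\{1,\dots,n\}\to\{1,\dots,r\}$ ($1\le r\le n$), written $(f(1),\dots,f(n))$, such that whenever $f(i)=f(j)$ with $i<j$, one has $f(k)\le f(i)$ for all $i\le k\le j$. $\mathcal K_{n,X}$ is the set of tuples $(f;x_1,\dots,x_r)$ with $f\in\mathcal K_n$ having image $\{1..r\}$ and $x_l\in X_{|f^{ -1}(l)|}$; it has degree $n$. For $(f;x_1,\dots,x_r)\in\mathcal K_{n,X}$, $(g;y_1,\dots,y_k)\in\mathcal K_{m,X}$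 and $0\le i\le m$: $(f;x_1..x_r)\bullet_i(g;y_1..y_k)=((g(1)+r,\dots,g(i)+r,f(1),\dots,f(n),g(i+1)+r,\dots,g(m)+r);x_1,\dots,x_r,y_1,\dots,y_k)$. $\xi_n$ denotes the constant map $\{1,\dots,n\}\to\{1\}$. -}

module Defs where

open import Algebra.Apartness.Bundles using (HeytingField; HeytingCommutativeRing)
open import Algebra.Bundles using (CommutativeRing)
open import Algebra.Module.Bundles using (Module)
open import Algebra.Module.Structures.Biased using (IsModuleFromLeft)
open import Algebra.Module.Morphism.Structures using (IsModuleHomomorphism)
open import Data.Fin as Fin using (Fin; zero; suc; toℕ; _↑ˡ_; _↑ʳ_; splitAt)
import Data.Fin.Properties as Fin
open import Data.Nat using (ℕ; zero; suc; _+_; _≤_; _<_; s≤s; z≤n; s≤s⁻¹)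
open import Data.Nat.Properties
open import Data.Product using (Σ; ∃; _×_; _,_; proj₁; proj₂)
open import Data.Sum using (_⊎_; inj₁; inj₂)
open import Data.Vec using (Vec; []; _∷_; _++_; map; lookup; cast; count; replicate)
open import Data.Vec.Properties
  using (lookup-map; lookup-++ˡ; lookup-++ʳ; lookup-replicate)
open import Function using (_∘_; flip)
open import Function.Definitions using (StrictlySurjective)
open import Level using (Level; _⊔_) renaming (suc to lsuc)
open import Relation.Binary.PropositionalEquality
open import Relation.Nullary using (yes; no; contradiction)

scalars : ∀ {c ℓ₁ ℓ₂} → HeytingField c ℓ₁ ℓ₂ → CommutativeRing c ℓ₁
scalars K = HeytingCommutativeRing.commutativeRing (HeytingField.heytingCommutativeRing K)

-- ⨁ₙ Aₙ is given by the family of its homogeneous components.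
GradedSpace : ∀ {c ℓ₁ ℓ₂} → HeytingField c ℓ₁ ℓ₂ →
              (a ℓa : Level) → Set (c ⊔ ℓ₁ ⊔ lsuc (a ⊔ ℓa))
GradedSpace K a ℓa = ℕ → Module (scalars K) a ℓa

module _ {c ℓ₁ ℓ₂} (K : HeytingField c ℓ₁ ℓ₂) where

  ∣_∣ : ∀ {a ℓa} → GradedSpace K a ℓa → ℕ → Set a
  ∣ A ∣ n = Module.Carrierᴹ (A n)

  IsLinear : ∀ {a ℓa b ℓb} (V : Module (scalars K) a ℓa) (W : Module (scalars K) b ℓb) →
             (Module.Carrierᴹ V → Module.Carrierᴹ W) → Set (c ⊔ a ⊔ ℓa ⊔ ℓb)
  IsLinear V W = IsModuleHomomorphism (Module.rawModule V) (Module.rawModule W)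

  -- ops x i _ y  is  x •ᵢ y,  defined for 0 ≤ i ≤ ∣y∣.
  Operations : ∀ {a ℓa} → GradedSpace K a ℓa → Set a
  Operations A = ∀ {n m} → ∣ A ∣ n → (i : ℕ) → .(i ≤ m) → ∣ A ∣ m → ∣ A ∣ (n + m)

  -- A linear map out of Aₙ ⊗ Aₘ is a map linear in each of its two arguments.
  -- The two sides of the associativity law lie in the components of
  -- degrees (n + m) + p and n + (m + p), hence the transport.
  record IsPreshuffleAlgebra {a ℓa} (A : GradedSpace K a ℓa) (_•[_,_]_ : Operations A)
                             : Set (c ⊔ a ⊔ ℓa) where
    field
      linearˡ : ∀ {n m i} (i≤m : i ≤ m) (y : ∣ A ∣ m) →
                IsLinear (A n) (A (n + m)) (λ x → x •[ i , i≤m ] y)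
      linearʳ : ∀ {n m i} (i≤m : i ≤ m) (x : ∣ A ∣ n) →
                IsLinear (A m) (A (n + m)) (λ y → x •[ i , i≤m ] y)
      assoc   : ∀ {n m p i j} (i≤m : i ≤ m) (j≤p : j ≤ p) →
                (x : ∣ A ∣ n) (y : ∣ A ∣ m) (z : ∣ A ∣ p) →
                Module._≈ᴹ_ (A (n + (m + p)))
                  (subst ∣ A ∣ (+-assoc n m p) ((x •[ i , i≤m ] y) •[ j , j≤p ] z))
                  (x •[ i + j , +-mono-≤ i≤m j≤p ] (y •[ j , j≤p ] z))

  GradedMap : ∀ {a ℓa b ℓb} → GradedSpace K a ℓa → GradedSpace K b ℓb → Set (a ⊔ b)
  GradedMap A B = ∀ n → ∣ A ∣ n → ∣ B ∣ n

  EqualMaps : ∀ {a ℓa b ℓb} (A : GradedSpace K a ℓa) (B : GradedSpace K b ℓb) →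
              GradedMap A B → GradedMap A B → Set (a ⊔ ℓb)
  EqualMaps A B Φ Ψ = ∀ n u → Module._≈ᴹ_ (B n) (Φ n u) (Ψ n u)

  record IsPreshuffleHomomorphism
           {a ℓa b ℓb} (A : GradedSpace K a ℓa) (B : GradedSpace K b ℓb)
           (_•ᴬ[_,_]_ : Operations A) (_•ᴮ[_,_]_ : Operations B)
           (Φ : GradedMap A B) : Set (c ⊔ a ⊔ ℓa ⊔ b ⊔ ℓb) where
    field
      linear : ∀ n → IsLinear (A n) (B n) (Φ n)
      homo   : ∀ {n m i} (i≤m : i ≤ m) (u : ∣ A ∣ n) (v : ∣ A ∣ m) →
               Module._≈ᴹ_ (B (n + m))
                 (Φ (n + m) (u •ᴬ[ i , i≤m ] v))
                 (Φ n u •ᴮ[ i , i≤m ] Φ m v)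

record PreshuffleAlgebra {c ℓ₁ ℓ₂} (K : HeytingField c ℓ₁ ℓ₂) (a ℓa : Level)
                         : Set (c ⊔ ℓ₁ ⊔ ℓ₂ ⊔ lsuc (a ⊔ ℓa)) where
  field
    space               : GradedSpace K a ℓa
    ops                 : Operations K space
    isPreshuffleAlgebra : IsPreshuffleAlgebra K space ops

-- insert i i≤m f g = (g(1),…,g(i),f(1),…,f(n),g(i+1),…,g(m))
insert : ∀ {a} {A : Set a} {n m} (i : ℕ) → .(i ≤ m) → Vec A n → Vec A m → Vec A (n + m)
insert zero    _    f g       = f ++ g
insert {n = n} {suc m} (suc i) i≤m f (y ∷ g) =
  cast (sym (+-suc n m)) (y ∷ insert i (s≤s⁻¹ i≤m) f g)

lookup-cast : ∀ {a} {A : Set a} {m n} .(eq : m ≡ n) (xs : Vec A m) (p : Fin n) →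
              ∃ λ q → toℕ q ≡ toℕ p × lookup (cast eq xs) p ≡ lookup xs q
lookup-cast {n = suc _} eq (x ∷ xs) zero    = zero , refl , refl
lookup-cast {n = suc _} eq (x ∷ xs) (suc p) with lookup-cast (cong Data.Nat.pred eq) xs p
... | q , e , e′ = suc q , cong suc e , e′

lookup-cast⁻ : ∀ {a} {A : Set a} {m n} .(eq : m ≡ n) (xs : Vec A m) (q : Fin m) →
               ∃ λ p → lookup (cast eq xs) p ≡ lookup xs q
lookup-cast⁻ {n = suc _} eq (x ∷ xs) zero    = zero , refl
lookup-cast⁻ {n = suc _} eq (x ∷ xs) (suc q) with lookup-cast⁻ (cong Data.Nat.pred eq) xs q
... | p , e = suc p , e

module _ {a} {A : Set a} where

  FromInner : ∀ {n m} → ℕ → Vec A n → Vec A (n + m) → Fin (n + m) → Set a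
  FromInner i f h p = ∃ λ b → toℕ p ≡ i + toℕ b × lookup h p ≡ lookup f b

  FromOuter : ∀ {n m} → ℕ → Vec A m → Vec A (n + m) → Fin (n + m) → Set a
  FromOuter {n} i g h p = ∃ λ b → lookup h p ≡ lookup g b ×
    ((toℕ p ≡ toℕ b × toℕ b < i) ⊎ (toℕ p ≡ n + toℕ b × i ≤ toℕ b))

  insert-origin : ∀ {n m} i .(i≤m : i ≤ m) (f : Vec A n) (g : Vec A m) p →
                  FromInner i f (insert i i≤m f g) p ⊎ FromOuter i g (insert i i≤m f g) p
  insert-origin {n} zero _ f g p with splitAt n p in eq
  ... | inj₁ b rewrite sym (Fin.splitAt⁻¹-↑ˡ {n} eq) =
    inj₁ (b , Fin.toℕ-↑ˡ b _ , lookup-++ˡ f g b)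
  ... | inj₂ b rewrite sym (Fin.splitAt⁻¹-↑ʳ {n} eq) =
    inj₂ (b , lookup-++ʳ f g b , inj₂ (Fin.toℕ-↑ʳ n b , z≤n))
  insert-origin {n} {suc m} (suc i) i≤m f (y ∷ g) p
    with lookup-cast (sym (+-suc n m)) (y ∷ insert i (s≤s⁻¹ i≤m) f g) p
  ... | zero  , e , e′ = inj₂ (zero , e′ , inj₁ (sym e , s≤s z≤n))
  ... | suc q , e , e′ with insert-origin i (s≤s⁻¹ i≤m) f g q
  ...   | inj₁ (b , d , d′) = inj₁ (b , trans (sym e) (cong suc d) , trans e′ d′)
  ...   | inj₂ (b , d′ , inj₁ (d , b<i)) =
    inj₂ (suc b , trans e′ d′ , inj₁ (trans (sym e) (cong suc d) , s≤s b<i))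
  ...   | inj₂ (b , d′ , inj₂ (d , i≤b)) =
    inj₂ (suc b , trans e′ d′ ,
          inj₂ (trans (sym e) (trans (cong suc d) (sym (+-suc n _))) , s≤s i≤b))

  insert-inner : ∀ {n m} i .(i≤m : i ≤ m) (f : Vec A n) (g : Vec A m) b →
                 ∃ λ p → lookup (insert i i≤m f g) p ≡ lookup f b
  insert-inner zero _ f g b = b ↑ˡ _ , lookup-++ˡ f g b
  insert-inner {n} {suc m} (suc i) i≤m f (y ∷ g) b
    with insert-inner i (s≤s⁻¹ i≤m) f g b
  ... | q , e with lookup-cast⁻ (sym (+-suc n m)) (y ∷ insert i (s≤s⁻¹ i≤m) f g) (suc q)
  ...   | p , e′ = p , trans e′ e

  insert-outer : ∀ {n m} i .(i≤m : i ≤ m) (f : Vec A n) (g : Vec A m) b →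
                 ∃ λ p → lookup (insert i i≤m f g) p ≡ lookup g b
  insert-outer {n} zero _ f g b = n ↑ʳ b , lookup-++ʳ f g b
  insert-outer {n} {suc m} (suc i) i≤m f (y ∷ g) zero =
    lookup-cast⁻ (sym (+-suc n m)) (y ∷ insert i (s≤s⁻¹ i≤m) f g) zero
  insert-outer {n} {suc m} (suc i) i≤m f (y ∷ g) (suc b)
    with insert-outer i (s≤s⁻¹ i≤m) f g b
  ... | q , e with lookup-cast⁻ (sym (+-suc n m)) (y ∷ insert i (s≤s⁻¹ i≤m) f g) (suc q)
  ...   | p , e′ = p , trans e′ e

fibreSize : ∀ {n r} → Vec (Fin r) n → Fin r → ℕ
fibreSize f l = count (Fin._≟ l) f

fibreSize-++ : ∀ {r n m} (f : Vec (Fin r) n) (g : Vec (Fin r) m) l →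
               fibreSize (f ++ g) l ≡ fibreSize f l + fibreSize g l
fibreSize-++ []      g l = refl
fibreSize-++ (x ∷ f) g l with x Fin.≟ l
... | yes _ = cong suc (fibreSize-++ f g l)
... | no  _ = fibreSize-++ f g l

fibreSize-cast : ∀ {r n m} .(eq : n ≡ m) (f : Vec (Fin r) n) l →
                 fibreSize (cast eq f) l ≡ fibreSize f l
fibreSize-cast {m = zero}  eq []      l = refl
fibreSize-cast {m = suc _} eq (x ∷ f) l with x Fin.≟ l
... | yes _ = cong suc (fibreSize-cast (cong Data.Nat.pred eq) f l)
... | no  _ = fibreSize-cast (cong Data.Nat.pred eq) f l

fibreSize-insert : ∀ {r n m} i .(i≤m : i ≤ m) (f : Vec (Fin r) n) (g : Vec (Fin r) m) l →
                   fibreSize (insert i i≤m f g) l ≡ fibreSize f l + fibreSize g l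
fibreSize-insert zero _ f g l = fibreSize-++ f g l
fibreSize-insert {n = n} {suc m} (suc i) i≤m f (y ∷ g) l
  rewrite fibreSize-cast (sym (+-suc n m)) (y ∷ insert i (s≤s⁻¹ i≤m) f g) l
  with y Fin.≟ l
... | yes _ = trans (cong suc (fibreSize-insert i (s≤s⁻¹ i≤m) f g l))
                    (sym (+-suc (fibreSize f l) (fibreSize g l)))
... | no  _ = fibreSize-insert i (s≤s⁻¹ i≤m) f g l

fibreSize-injective : ∀ {r s n} (h : Fin r → Fin s) → (∀ {x y} → h x ≡ h y → x ≡ y) →
                      (f : Vec (Fin r) n) (l : Fin r) →
                      fibreSize (map h f) (h l) ≡ fibreSize f l
fibreSize-injective h inj []      l = refl
fibreSize-injective h inj (x ∷ f) l with h x Fin.≟ h l | x Fin.≟ l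
... | yes _  | yes _    = cong suc (fibreSize-injective h inj f l)
... | no  _  | no  _    = fibreSize-injective h inj f l
... | yes e  | no  x≢l  = contradiction (inj e) x≢l
... | no  ne | yes refl = contradiction refl ne

fibreSize-disjoint : ∀ {r s n} (h : Fin r → Fin s) (l : Fin s) → (∀ x → h x ≢ l) →
                     (f : Vec (Fin r) n) → fibreSize (map h f) l ≡ 0
fibreSize-disjoint h l ne []      = refl
fibreSize-disjoint h l ne (x ∷ f) with h x Fin.≟ l
... | yes e = contradiction e (ne x)
... | no  _ = fibreSize-disjoint h l ne f

fibreSize-constant : ∀ n → fibreSize (replicate n (zero {0})) zero ≡ n
fibreSize-constant zero    = refl
fibreSize-constant (suc n) = cong suc (fibreSize-constant n)

-- If f(i) = f(j) with i < j, then f(k) ≤ f(i) for all i ≤ k ≤ j.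
NoPeaks : ∀ {n r} → Vec (Fin r) n → Set
NoPeaks {n} f = ∀ (i j k : Fin n) → i Fin.< j → lookup f i ≡ lookup f j →
                i Fin.≤ k → k Fin.≤ j → lookup f k Fin.≤ lookup f i

-- {1,…,r} is represented by Fin r.  The conditions are irrelevant fields, so
-- two elements are equal exactly when they are the same sequence.
record 𝒦 (n : ℕ) : Set where
  constructor mk𝒦
  field
    {r}         : ℕ
    .1≤r        : 1 ≤ r
    .r≤n        : r ≤ n
    values      : Vec (Fin r) n
    .surjective : StrictlySurjective _≡_ (lookup values)
    .noPeaks    : NoPeaks values

ξ : ∀ n → .(1 ≤ n) → 𝒦 n
ξ n 1≤n = mk𝒦 (s≤s z≤n) 1≤n (replicate n zero) (surj n 1≤n) λ i j k _ _ _ _ →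
    subst₂ Fin._≤_ (sym (lookup-replicate k zero)) (sym (lookup-replicate i zero)) z≤n
  where
  surj : ∀ n → 1 ≤ n → StrictlySurjective _≡_ (lookup (replicate n (zero {0})))
  surj (suc n) _ zero = zero , refl

shuffle : ∀ {n m r k} (i : ℕ) → .(i ≤ m) → Vec (Fin r) n → Vec (Fin k) m →
          Vec (Fin (r + k)) (n + m)
shuffle {r = r} {k} i i≤m f g = insert i i≤m (map (_↑ˡ k) f) (map (r ↑ʳ_) g)

module _ {n m r k : ℕ} {i : ℕ} .(i≤m : i ≤ m) (f : Vec (Fin r) n) (g : Vec (Fin k) m) where

  private
    f↑ : Vec (Fin (r + k)) n
    f↑ = map (_↑ˡ k) f
    g↑ : Vec (Fin (r + k)) m
    g↑ = map (r ↑ʳ_) g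
    h : Vec (Fin (r + k)) (n + m)
    h = shuffle i i≤m f g

  shuffle-surjective : StrictlySurjective _≡_ (lookup f) → StrictlySurjective _≡_ (lookup g) →
                       StrictlySurjective _≡_ (lookup h)
  shuffle-surjective sf sg l with splitAt r l in eq
  ... | inj₁ a with sf a
  ...   | b , e with insert-inner i i≤m f↑ g↑ b
  ...     | p , e′ = p , trans e′ (trans (lookup-map b _ f)
                         (trans (cong (_↑ˡ k) e) (Fin.splitAt⁻¹-↑ˡ {r} eq)))
  shuffle-surjective sf sg l | inj₂ a with sg a
  ...   | b , e with insert-outer i i≤m f↑ g↑ b
  ...     | p , e′ = p , trans e′ (trans (lookup-map b _ g)
                         (trans (cong (r ↑ʳ_) e) (Fin.splitAt⁻¹-↑ʳ {r} eq)))

  private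
    low : ∀ {p b} → lookup h p ≡ lookup f↑ b → toℕ (lookup h p) ≡ toℕ (lookup f b)
    low {b = b} e = trans (cong toℕ (trans e (lookup-map b _ f))) (Fin.toℕ-↑ˡ _ k)

    high : ∀ {p b} → lookup h p ≡ lookup g↑ b → toℕ (lookup h p) ≡ r + toℕ (lookup g b)
    high {b = b} e = trans (cong toℕ (trans e (lookup-map b _ g))) (Fin.toℕ-↑ʳ r _)

    low≢high : ∀ {p q b d} → lookup h p ≡ lookup f↑ b → lookup h q ≡ lookup g↑ d →
               lookup h p ≢ lookup h q
    low≢high {b = b} {d} e e′ eq = <-irrefl
      (trans (sym (low e)) (trans (cong toℕ eq) (high e′)))
      (≤-trans (Fin.toℕ<n (lookup f b)) (m≤m+n r _))

    Pos : Fin (n + m) → Fin m → Set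
    Pos p b = (toℕ p ≡ toℕ b × toℕ b < i) ⊎ (toℕ p ≡ n + toℕ b × i ≤ toℕ b)

    reflect-≤ : ∀ {p q b d} → Pos p b → Pos q d → p Fin.≤ q → b Fin.≤ d
    reflect-≤ (inj₁ (e , _))   (inj₁ (e′ , _))   p≤q = subst₂ _≤_ e e′ p≤q
    reflect-≤ (inj₁ (_ , b<i)) (inj₂ (_ , i≤d))  p≤q = <⇒≤ (≤-trans b<i i≤d)
    reflect-≤ {b = b} (inj₂ (e , i≤b)) (inj₁ (e′ , d<i)) p≤q =
      contradiction (≤-trans (m≤n+m (toℕ b) n) (subst₂ _≤_ e e′ p≤q))
                    (<⇒≱ (≤-trans d<i i≤b))
    reflect-≤ (inj₂ (e , _))   (inj₂ (e′ , _))   p≤q =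
      +-cancelˡ-≤ n _ _ (subst₂ _≤_ e e′ p≤q)

    reflect-< : ∀ {p q b d} → Pos p b → Pos q d → p Fin.< q → b Fin.< d
    reflect-< {p} {q} {b} {d} P Q p<q =
      ≤∧≢⇒< (reflect-≤ P Q (<⇒≤ p<q)) λ e →
        <⇒≱ p<q (unique P Q e)
      where
      unique : Pos p b → Pos q d → toℕ b ≡ toℕ d → toℕ q ≤ toℕ p
      unique (inj₁ (e , _))   (inj₁ (e′ , _))  eq = ≤-reflexive (trans e′ (trans (sym eq) (sym e)))
      unique (inj₁ (_ , b<i)) (inj₂ (_ , i≤d)) eq = contradiction (subst (_< i) eq b<i) (≤⇒≯ i≤d)
      unique (inj₂ (_ , i≤b)) (inj₁ (_ , d<i)) eq = contradiction (subst (i ≤_) eq i≤b) (<⇒≱ d<i)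
      unique (inj₂ (e , _))   (inj₂ (e′ , _))  eq =
        ≤-reflexive (trans e′ (trans (cong (n +_) (sym eq)) (sym e)))

  shuffle-noPeaks : NoPeaks f → NoPeaks g → NoPeaks h
  shuffle-noPeaks nf ng s t u s<t s≡t s≤u u≤t
    with insert-origin i i≤m f↑ g↑ s | insert-origin i i≤m f↑ g↑ t | insert-origin i i≤m f↑ g↑ u
  ... | inj₁ (_ , _ , e) | inj₂ (_ , e′ , _) | _ = contradiction s≡t (low≢high e e′)
  ... | inj₂ (_ , e , _) | inj₁ (_ , _ , e′) | _ = contradiction (sym s≡t) (low≢high e′ e)
  ... | inj₁ (b , d , e) | inj₁ (b′ , d′ , e′) | inj₁ (b″ , d″ , e″) =
    subst₂ _≤_ (sym (low e″)) (sym (low e))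
      (nf b b′ b″ (+-cancelˡ-< i _ _ (subst₂ _<_ d d′ s<t))
        (Fin.toℕ-injective (trans (sym (low e)) (trans (cong toℕ s≡t) (low e′))))
        (+-cancelˡ-≤ i _ _ (subst₂ _≤_ d d″ s≤u))
        (+-cancelˡ-≤ i _ _ (subst₂ _≤_ d″ d′ u≤t)))
  ... | inj₁ (b , d , e) | inj₁ (b′ , d′ , e′) | inj₂ (b″ , e″ , inj₁ (d″ , b″<i)) =
    contradiction (≤-trans (m≤m+n i _) (subst₂ _≤_ d d″ s≤u)) (<⇒≱ b″<i)
  ... | inj₁ (b , d , e) | inj₁ (b′ , d′ , e′) | inj₂ (b″ , e″ , inj₂ (d″ , i≤b″)) =
    contradiction (subst₂ _≤_ d″ d′ u≤t)
      (<⇒≱ (≤-trans (+-monoʳ-< i (Fin.toℕ<n b′))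
                    (subst (_≤ n + toℕ b″) (+-comm n i) (+-monoʳ-≤ n i≤b″))))
  ... | inj₂ (b , e , P) | inj₂ (b′ , e′ , P′) | inj₁ (b″ , d″ , e″) =
    subst₂ _≤_ (sym (low e″)) (sym (high e))
      (≤-trans (<⇒≤ (Fin.toℕ<n (lookup f b″))) (m≤m+n r _))
  ... | inj₂ (b , e , P) | inj₂ (b′ , e′ , P′) | inj₂ (b″ , e″ , P″) =
    subst₂ _≤_ (sym (high e″)) (sym (high e))
      (+-monoʳ-≤ r
        (ng b b′ b″ (reflect-< P P′ s<t)
          (Fin.toℕ-injective (+-cancelˡ-≡ r _ _
            (trans (sym (high e)) (trans (cong toℕ s≡t) (high e′)))))
          (reflect-≤ P P″ s≤u) (reflect-≤ P″ P′ u≤t)))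

  fibreSize-shuffleˡ : ∀ l → fibreSize h (l ↑ˡ k) ≡ fibreSize f l
  fibreSize-shuffleˡ l = trans (fibreSize-insert i i≤m f↑ g↑ (l ↑ˡ k))
    (trans (cong₂ _+_ (fibreSize-injective (_↑ˡ k) (Fin.↑ˡ-injective k _ _) f l)
                      (fibreSize-disjoint (r ↑ʳ_) (l ↑ˡ k)
                        (λ x e → <⇒≱ (Fin.toℕ<n l) (≤-trans (m≤m+n r (toℕ x))
                          (≤-reflexive (trans (sym (Fin.toℕ-↑ʳ r x))
                            (trans (cong toℕ e) (Fin.toℕ-↑ˡ l k)))))) g))
           (+-identityʳ _))

  fibreSize-shuffleʳ : ∀ l → fibreSize h (r ↑ʳ l) ≡ fibreSize g l
  fibreSize-shuffleʳ l = trans (fibreSize-insert i i≤m f↑ g↑ (r ↑ʳ l))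
    (cong₂ _+_ (fibreSize-disjoint (_↑ˡ k) (r ↑ʳ l)
                 (λ x e → <⇒≱ (Fin.toℕ<n x) (≤-trans (m≤m+n r (toℕ l))
                   (≤-reflexive (trans (sym (Fin.toℕ-↑ʳ r l))
                     (trans (cong toℕ (sym e)) (Fin.toℕ-↑ˡ x k)))))) f)
               (fibreSize-injective (r ↑ʳ_) (Fin.↑ʳ-injective r _ _) g l))

record PositivelyGradedSet x : Set (lsuc x) where
  field
    component : ℕ → Set x
    positive  : ∀ {n} → component n → 1 ≤ n

  Total : Set x
  Total = Σ ℕ component

open PositivelyGradedSet using (component; positive; Total)

-- The tuple (f ; x₁,…,xᵣ) with x_l ∈ X of degree ∣f⁻¹(l)∣.
record 𝒦[_] {x} (X : PositivelyGradedSet x) (n : ℕ) : Set x where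
  constructor mk
  field
    map-of  : 𝒦 n
    labels  : Vec (Total X) (𝒦.r map-of)
    .degree : ∀ l → proj₁ (lookup labels l) ≡ fibreSize (𝒦.values map-of) l

module _ {x} {X : PositivelyGradedSet x} where

  ξ[_] : ∀ {n} → component X n → 𝒦[ X ] n
  ξ[_] {n} x = mk (ξ n (positive X x)) ((n , x) ∷ [])
                  λ { zero → sym (fibreSize-constant n) }

  infix 8 _•ᴷ[_,_]_
  _•ᴷ[_,_]_ : ∀ {n m} → 𝒦[ X ] n → (i : ℕ) → .(i ≤ m) → 𝒦[ X ] m → 𝒦[ X ] (n + m)
  mk (mk𝒦 {r} 1≤r r≤n f sf nf) xs df •ᴷ[ i , i≤m ] mk (mk𝒦 {k} _ k≤m g sg ng) ys dg =
    mk (mk𝒦 (≤-trans 1≤r (m≤m+n r k)) (+-mono-≤ r≤n k≤m) (shuffle i i≤m f g)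
            (shuffle-surjective i≤m f g sf sg) (shuffle-noPeaks i≤m f g nf ng))
       (xs ++ ys) (deg df dg)
    where
    deg : (∀ l → proj₁ (lookup xs l) ≡ fibreSize f l) →
          (∀ l → proj₁ (lookup ys l) ≡ fibreSize g l) →
          ∀ l → proj₁ (lookup (xs ++ ys) l) ≡ fibreSize (shuffle i i≤m f g) l
    deg df dg l with splitAt r l in eq
    ... | inj₁ a rewrite sym (Fin.splitAt⁻¹-↑ˡ {r} eq) =
      trans (cong proj₁ (lookup-++ˡ xs ys a))
            (trans (df a) (sym (fibreSize-shuffleˡ i≤m f g a)))
    ... | inj₂ a rewrite sym (Fin.splitAt⁻¹-↑ʳ {r} eq) =
      trans (cong proj₁ (lookup-++ʳ xs ys a))
            (trans (dg a) (sym (fibreSize-shuffleʳ i≤m f g a)))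

module FreeSpace {c ℓ₁ ℓ₂} (K : HeytingField c ℓ₁ ℓ₂) where

  private module K = HeytingField K

  infixl 6 _⊕_
  infixr 7 _·_
  infix  4 _≈_

  -- The vector space with basis S: linear combinations of elements of S, modulo the congruence _≈_ generated
  -- by the vector space axioms.
  data K[_] {s} (S : Set s) : Set (c ⊔ s) where
    [_]  : S → K[ S ]
    𝟎    : K[ S ]
    _⊕_  : K[ S ] → K[ S ] → K[ S ]
    ⊖_   : K[ S ] → K[ S ]
    _·_  : K.Carrier → K[ S ] → K[ S ]

  data _≈_ {s} {S : Set s} : K[ S ] → K[ S ] → Set (c ⊔ ℓ₁ ⊔ s) where
    ≈-refl     : ∀ {u} → u ≈ u
    ≈-sym      : ∀ {u v} → u ≈ v → v ≈ u
    ≈-trans    : ∀ {u v w} → u ≈ v → v ≈ w → u ≈ w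
    ⊕-cong     : ∀ {u u′ v v′} → u ≈ u′ → v ≈ v′ → u ⊕ v ≈ u′ ⊕ v′
    ⊖-cong     : ∀ {u u′} → u ≈ u′ → ⊖ u ≈ ⊖ u′
    ·-cong     : ∀ {a a′ u u′} → a K.≈ a′ → u ≈ u′ → a · u ≈ a′ · u′
    ⊕-assoc    : ∀ u v w → (u ⊕ v) ⊕ w ≈ u ⊕ (v ⊕ w)
    ⊕-comm     : ∀ u v → u ⊕ v ≈ v ⊕ u
    ⊕-identity : ∀ u → 𝟎 ⊕ u ≈ u
    ⊕-inverse  : ∀ u → (⊖ u) ⊕ u ≈ 𝟎
    ·-distribˡ : ∀ a u v → a · (u ⊕ v) ≈ a · u ⊕ a · v
    ·-distribʳ : ∀ u a b → (a K.+ b) · u ≈ a · u ⊕ b · u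
    ·-assoc    : ∀ a b u → (a K.* b) · u ≈ a · (b · u)
    ·-identity : ∀ u → K.1# · u ≈ u
    ·-zeroˡ    : ∀ u → K.0# · u ≈ 𝟎
    ·-zeroʳ    : ∀ a → a · 𝟎 {S = S} ≈ 𝟎

  space : ∀ {s} → Set s → Module (scalars K) (c ⊔ s) (c ⊔ ℓ₁ ⊔ s)
  space S = record
    { Carrierᴹ = K[ S ]
    ; _≈ᴹ_     = _≈_
    ; _+ᴹ_     = _⊕_
    ; _*ₗ_     = _·_
    ; _*ᵣ_     = flip _·_
    ; 0ᴹ       = 𝟎
    ; -ᴹ_      = ⊖_
    ; isModule = IsModuleFromLeft.isModule {commutativeRing = scalars K} (record
      { isLeftModule = record
        { isLeftSemimodule = record
          { +ᴹ-isCommutativeMonoid = record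
            { isMonoid = record
              { isSemigroup = record
                { isMagma = record
                  { isEquivalence = record { refl = ≈-refl ; sym = ≈-sym ; trans = ≈-trans }
                  ; ∙-cong        = ⊕-cong
                  }
                ; assoc = ⊕-assoc
                }
              ; identity = ⊕-identity
                         , λ u → ≈-trans (⊕-comm u 𝟎) (⊕-identity u)
              }
            ; comm = ⊕-comm
            }
          ; isPreleftSemimodule = record
            { *ₗ-cong      = ·-cong
            ; *ₗ-zeroˡ     = ·-zeroˡ
            ; *ₗ-distribʳ  = ·-distribʳ
            ; *ₗ-identityˡ = ·-identity
            ; *ₗ-assoc     = ·-assoc
            ; *ₗ-zeroʳ     = ·-zeroʳ
            ; *ₗ-distribˡ  = ·-distribˡ
            }
          }
        ; -ᴹ‿cong    = ⊖-cong
        ; -ᴹ‿inverse = ⊕-inverse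
                     , λ u → ≈-trans (⊕-comm u (⊖ u)) (⊕-inverse u)
        }
      })
    }

  linearExtension : ∀ {s t} {S : Set s} {T : Set t} → (S → K[ T ]) → K[ S ] → K[ T ]
  linearExtension h [ s ]   = h s
  linearExtension h 𝟎       = 𝟎
  linearExtension h (u ⊕ v) = linearExtension h u ⊕ linearExtension h v
  linearExtension h (⊖ u)   = ⊖ linearExtension h u
  linearExtension h (a · u) = a · linearExtension h u

  bilinearExtension : ∀ {s t u} {S : Set s} {T : Set t} {U : Set u} →
                      (S → T → U) → K[ S ] → K[ T ] → K[ U ]
  bilinearExtension h p q =
    linearExtension (λ s → linearExtension (λ t → [ h s t ]) q) p

module _ {c ℓ₁ ℓ₂ x} (K : HeytingField c ℓ₁ ℓ₂) (X : PositivelyGradedSet x) where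

  open FreeSpace K

  -- 𝒦₀ is empty because of the condition 1 ≤ r ≤ n, so the component of
  -- degree 0 is the zero space.
  K[𝒦∞] : GradedSpace K (c ⊔ x) (c ⊔ ℓ₁ ⊔ x)
  K[𝒦∞] n = space (𝒦[ X ] n)

  shuffleOps : Operations K K[𝒦∞]
  shuffleOps u i i≤m v = bilinearExtension (λ f g → f •ᴷ[ i , i≤m ] g) u v

  generator : ∀ {n} → component X n → K[ 𝒦[ X ] n ]
  generator x = [ ξ[ x ] ]

{-# OPTIONS --safe #-}

-- In a peak-free sequence f the positions of the smallest value form a block,
-- so (f; x₁,…,xᵣ) = (ξ_d; x₁) •ᵢ (g; x₂,…,xᵣ), where d is the degree of x₁, i the
-- position of the block, and g what is left of f when it is deleted.  The pair
-- (i, g) is determined by f, and associativity keeps (f; x) •ⱼ (h; y) in this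
-- form: it is (ξ_d; x₁) •ᵢ₊ⱼ ((g; x₂,…,xᵣ) •ⱼ (h; y)).  Hence a homomorphism is
-- determined by its values on the (ξ_d; x), and the recursion
-- Φ(f; x₁,…,xᵣ) = φ(x₁) •ᵢ Φ(g; x₂,…,xᵣ) does define one.
module Submission where

open import Defs
open import Algebra.Apartness.Bundles using (HeytingField)
open import Algebra.Bundles using (AbelianGroup)
open import Algebra.Module.Bundles using (Module)
import Algebra.Module.Morphism.Construct.Composition as Composition
import Algebra.Module.Morphism.Construct.Identity as Identity
open import Algebra.Module.Morphism.Structures using (IsModuleHomomorphism)
import Algebra.Properties.AbelianGroup as AbelianGroupProperties
import Algebra.Properties.CommutativeSemigroup as CommutativeSemigroupProperties
open import Data.Bool using (if_then_else_; true; false)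
open import Data.Fin as Fin using (Fin; zero; suc; toℕ)
import Data.Fin.Properties as Fin
open import Data.List as List using (List; []; _∷_; _++_; length; map; replicate)
open import Data.List.Membership.Propositional using (_∈_)
open import Data.List.Properties as List
  using (++-assoc; ++-identityʳ; length-map; map-++; map-∘; map-cong; ≡-dec)
open import Data.List.Relation.Unary.All using (All; []; _∷_)
open import Data.List.Relation.Unary.Any using (here; there)
open import Data.Nat using (ℕ; zero; suc; _+_; _≤_; _<_; _≡ᵇ_; _⊓_; z≤n; s≤s; s≤s⁻¹; _≟_)
open import Data.Nat.Properties as ℕ using (+-suc; +-identityʳ; +-assoc; m⊓n≤n; m≤n⇒m⊓n≡m)
open import Data.Product using (Σ; ∃; ∃₂; ∃!; _×_; _,_; proj₁)
open import Data.Vec as Vec using (Vec; []; _∷_; toList)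
import Data.Vec.Properties as Vec
open import Function using (_∘_; id)
open import Level using (_⊔_)
open import Relation.Binary.PropositionalEquality hiding ([_])
import Relation.Binary.Reasoning.Setoid as SetoidReasoning
open import Relation.Nullary using (¬_; contradiction; does; recompute)

open FreeSpace using (K[_])
open PositivelyGradedSet using (component; positive; Total)

-- Linear maps out of free spaces

module _ {c ℓ₁ ℓ₂} (K : HeytingField c ℓ₁ ℓ₂) where

  private
    module K = HeytingField K
    open module F = FreeSpace K using ([_]; 𝟎; _⊕_; ⊖_; _·_)

  module _ {a ℓa b ℓb} (V : Module (scalars K) a ℓa) (W : Module (scalars K) b ℓb) where

    private
      module V = Module V
      module W = Module W
    open AbelianGroupProperties W.+ᴹ-abelianGroup using (inverseˡ-unique)
    open SetoidReasoning W.≈ᴹ-setoid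

    -- Additivity and homogeneity force the rest: zero is `0# *ₗ 0ᴹ`, inverses are unique, and the
    -- right action coincides with the left one.
    mkLinear : {F : V.Carrierᴹ → W.Carrierᴹ} →
               (∀ {u v} → u V.≈ᴹ v → F u W.≈ᴹ F v) →
               (∀ u v → F (u V.+ᴹ v) W.≈ᴹ F u W.+ᴹ F v) →
               (∀ k u → F (k V.*ₗ u) W.≈ᴹ k W.*ₗ F u) →
               IsLinear K V W F
    mkLinear {F} F-cong F-+ F-* = record
      { isBimoduleHomomorphism = record
        { +ᴹ-isGroupHomomorphism = record
          { isMonoidHomomorphism = record
            { isMagmaHomomorphism = record
              { isRelHomomorphism = record { cong = F-cong }
              ; homo = F-+
              }
            ; ε-homo = F-0
            }
          ; ⁻¹-homo = λ u → inverseˡ-unique (F (V.-ᴹ u)) (F u) (begin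
              F (V.-ᴹ u) W.+ᴹ F u ≈⟨ F-+ (V.-ᴹ u) u ⟨
              F (V.-ᴹ u V.+ᴹ u)   ≈⟨ F-cong (V.-ᴹ‿inverseˡ u) ⟩
              F V.0ᴹ              ≈⟨ F-0 ⟩
              W.0ᴹ                ∎)
          }
        ; *ₗ-homo = F-*
        ; *ᵣ-homo = λ k u → begin
            F (u V.*ᵣ k) ≈⟨ F-cong (V.*ₗ-*ᵣ-coincident k u) ⟨
            F (k V.*ₗ u) ≈⟨ F-* k u ⟩
            k W.*ₗ F u   ≈⟨ W.*ₗ-*ᵣ-coincident k (F u) ⟩
            F u W.*ᵣ k   ∎
        }
      }
      where
      F-0 : F V.0ᴹ W.≈ᴹ W.0ᴹ
      F-0 = begin
        F V.0ᴹ             ≈⟨ F-cong (V.*ₗ-zeroˡ V.0ᴹ) ⟨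
        F (K.0# V.*ₗ V.0ᴹ) ≈⟨ F-* K.0# V.0ᴹ ⟩
        K.0# W.*ₗ F V.0ᴹ   ≈⟨ W.*ₗ-zeroˡ (F V.0ᴹ) ⟩
        W.0ᴹ               ∎

    zero-linear : IsLinear K V W (λ _ → W.0ᴹ)
    zero-linear = mkLinear (λ _ → W.≈ᴹ-refl) (λ _ _ → W.≈ᴹ-sym (W.+ᴹ-identityˡ W.0ᴹ))
                           (λ k _ → W.≈ᴹ-sym (W.*ₗ-zeroʳ k))

    module _ {F G : V.Carrierᴹ → W.Carrierᴹ} (F-linear : IsLinear K V W F) (G-linear : IsLinear K V W G) where

      private
        module F-lin = IsModuleHomomorphism F-linear
        module G-lin = IsModuleHomomorphism G-linear
      open CommutativeSemigroupProperties
        (AbelianGroup.commutativeSemigroup W.+ᴹ-abelianGroup) using (interchange)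

      +-linear : IsLinear K V W (λ u → F u W.+ᴹ G u)
      +-linear = mkLinear
        (λ u≈v → W.+ᴹ-cong (F-lin.⟦⟧-cong u≈v) (G-lin.⟦⟧-cong u≈v))
        (λ u v → W.≈ᴹ-trans (W.+ᴹ-cong (F-lin.+ᴹ-homo u v) (G-lin.+ᴹ-homo u v))
                            (interchange (F u) (F v) (G u) (G v)))
        (λ k u → W.≈ᴹ-trans (W.+ᴹ-cong (F-lin.*ₗ-homo k u) (G-lin.*ₗ-homo k u))
                            (W.≈ᴹ-sym (W.*ₗ-distribˡ k (F u) (G u))))

    module _ {F : V.Carrierᴹ → W.Carrierᴹ} (F-linear : IsLinear K V W F) where

      private module F-lin = IsModuleHomomorphism F-linear

      *-linear : ∀ k → IsLinear K V W (λ u → k W.*ₗ F u)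
      *-linear k = mkLinear
        (λ u≈v → W.*ₗ-congˡ (F-lin.⟦⟧-cong u≈v))
        (λ u v → W.≈ᴹ-trans (W.*ₗ-congˡ (F-lin.+ᴹ-homo u v)) (W.*ₗ-distribˡ k (F u) (F v)))
        (λ l u → begin
          k W.*ₗ F (l V.*ₗ u)    ≈⟨ W.*ₗ-congˡ (F-lin.*ₗ-homo l u) ⟩
          k W.*ₗ (l W.*ₗ F u)    ≈⟨ W.*ₗ-assoc k l (F u) ⟨
          (k K.* l) W.*ₗ F u     ≈⟨ W.*ₗ-congʳ (K.*-comm k l) ⟩
          (l K.* k) W.*ₗ F u     ≈⟨ W.*ₗ-assoc l k (F u) ⟩
          l W.*ₗ (k W.*ₗ F u)    ∎)

      -‿linear : IsLinear K V W (λ u → W.-ᴹ F u)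
      -‿linear = mkLinear
        (λ u≈v → W.-ᴹ‿cong (F-lin.⟦⟧-cong u≈v))
        (λ u v → W.≈ᴹ-trans (W.-ᴹ‿cong (F-lin.+ᴹ-homo u v)) (W.≈ᴹ-sym (⁻¹-∙-comm (F u) (F v))))
        (λ k u → begin
          W.-ᴹ F (k V.*ₗ u)    ≈⟨ W.-ᴹ‿cong (F-lin.*ₗ-homo k u) ⟩
          W.-ᴹ (k W.*ₗ F u)    ≈⟨ inverseˡ-unique _ _ (begin
            k W.*ₗ (W.-ᴹ F u) W.+ᴹ k W.*ₗ F u  ≈⟨ W.*ₗ-distribˡ k _ _ ⟨
            k W.*ₗ (W.-ᴹ F u W.+ᴹ F u)         ≈⟨ W.*ₗ-congˡ (W.-ᴹ‿inverseˡ (F u)) ⟩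
            k W.*ₗ W.0ᴹ                        ≈⟨ W.*ₗ-zeroʳ k ⟩
            W.0ᴹ                               ∎) ⟨
          k W.*ₗ (W.-ᴹ F u)    ∎)
        where open AbelianGroupProperties W.+ᴹ-abelianGroup using (⁻¹-∙-comm)

  ∘-linear : ∀ {a ℓa b ℓb d ℓd} (U : Module (scalars K) a ℓa) (V : Module (scalars K) b ℓb)
             (W : Module (scalars K) d ℓd) {F : Module.Carrierᴹ U → Module.Carrierᴹ V}
             {G : Module.Carrierᴹ V → Module.Carrierᴹ W} →
             IsLinear K U V F → IsLinear K V W G → IsLinear K U W (G ∘ F)
  ∘-linear U V W = Composition.isModuleHomomorphism (Module.≈ᴹ-trans W)

  subst-linear : ∀ {a ℓa} (A : GradedSpace K a ℓa) {n m} (e : n ≡ m) →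
                 IsLinear K (A n) (A m) (subst (∣_∣ K A) e)
  subst-linear A {n} refl = Identity.isModuleHomomorphism _ (Module.≈ᴹ-refl (A n))

  module _ {s b ℓb} {S : Set s} (W : Module (scalars K) b ℓb) where

    private module W = Module W

    extend : (S → W.Carrierᴹ) → K[_] K S → W.Carrierᴹ
    extend h [ s ]   = h s
    extend h 𝟎       = W.0ᴹ
    extend h (u ⊕ v) = extend h u W.+ᴹ extend h v
    extend h (⊖ u)   = W.-ᴹ extend h u
    extend h (k · u) = k W.*ₗ extend h u

    -- Each generator of `F._≈_` is an equivalence or congruence rule or a vector space axiom, and
    -- `W` satisfies the same law.
    extend-cong : ∀ h {u v} → u F.≈ v → extend h u W.≈ᴹ extend h v
    extend-cong h F.≈-refl            = W.≈ᴹ-refl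
    extend-cong h (F.≈-sym p)         = W.≈ᴹ-sym (extend-cong h p)
    extend-cong h (F.≈-trans p q)     = W.≈ᴹ-trans (extend-cong h p) (extend-cong h q)
    extend-cong h (F.⊕-cong p q)      = W.+ᴹ-cong (extend-cong h p) (extend-cong h q)
    extend-cong h (F.⊖-cong p)        = W.-ᴹ‿cong (extend-cong h p)
    extend-cong h (F.·-cong p q)      = W.*ₗ-cong p (extend-cong h q)
    extend-cong h (F.⊕-assoc u v w)   = W.+ᴹ-assoc _ _ _
    extend-cong h (F.⊕-comm u v)      = W.+ᴹ-comm _ _
    extend-cong h (F.⊕-identity u)    = W.+ᴹ-identityˡ _
    extend-cong h (F.⊕-inverse u)     = W.-ᴹ‿inverseˡ _
    extend-cong h (F.·-distribˡ k u v) = W.*ₗ-distribˡ k _ _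
    extend-cong h (F.·-distribʳ u k l) = W.*ₗ-distribʳ _ k l
    extend-cong h (F.·-assoc k l u)   = W.*ₗ-assoc k l _
    extend-cong h (F.·-identity u)    = W.*ₗ-identityˡ _
    extend-cong h (F.·-zeroˡ u)       = W.*ₗ-zeroˡ _
    extend-cong h (F.·-zeroʳ k)       = W.*ₗ-zeroʳ k

    extend-linear : ∀ h → IsLinear K (F.space S) W (extend h)
    extend-linear h = mkLinear (F.space S) W (extend-cong h)
                               (λ _ _ → W.≈ᴹ-refl) (λ _ _ → W.≈ᴹ-refl)

    -- Elements of the free space are formal expressions in the basis, so induction on the
    -- expression suffices. The multilinear identities below are reduced to basis elements in this
    -- way.
    linear-unique : {F G : K[_] K S → W.Carrierᴹ} →
                    IsLinear K (F.space S) W F → IsLinear K (F.space S) W G →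
                    (∀ s → F [ s ] W.≈ᴹ G [ s ]) → ∀ u → F u W.≈ᴹ G u
    linear-unique {F} {G} F-linear G-linear agree = go
      where
      module F-lin = IsModuleHomomorphism F-linear
      module G-lin = IsModuleHomomorphism G-linear
      go : ∀ u → F u W.≈ᴹ G u
      go [ s ]   = agree s
      go 𝟎       = W.≈ᴹ-trans F-lin.0ᴹ-homo (W.≈ᴹ-sym G-lin.0ᴹ-homo)
      go (u ⊕ v) = W.≈ᴹ-trans (F-lin.+ᴹ-homo u v)
                     (W.≈ᴹ-trans (W.+ᴹ-cong (go u) (go v)) (W.≈ᴹ-sym (G-lin.+ᴹ-homo u v)))
      go (⊖ u)   = W.≈ᴹ-trans (F-lin.-ᴹ-homo u)
                     (W.≈ᴹ-trans (W.-ᴹ‿cong (go u)) (W.≈ᴹ-sym (G-lin.-ᴹ-homo u)))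
      go (k · u) = W.≈ᴹ-trans (F-lin.*ₗ-homo k u)
                     (W.≈ᴹ-trans (W.*ₗ-congˡ (go u)) (W.≈ᴹ-sym (G-lin.*ₗ-homo k u)))

  -- Lets `linearExtension` inherit its well-definedness from `extend-cong`.
  linearExtension≡extend : ∀ {s t} {S : Set s} {T : Set t} (h : S → K[_] K T) u →
                           F.linearExtension h u ≡ extend (F.space T) h u
  linearExtension≡extend h [ s ]   = refl
  linearExtension≡extend h 𝟎       = refl
  linearExtension≡extend h (u ⊕ v) = cong₂ _⊕_ (linearExtension≡extend h u) (linearExtension≡extend h v)
  linearExtension≡extend h (⊖ u)   = cong ⊖_ (linearExtension≡extend h u)
  linearExtension≡extend h (k · u) = cong (k ·_) (linearExtension≡extend h u)

  linearExtension-linear : ∀ {s t} {S : Set s} {T : Set t} (h : S → K[_] K T) →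
                           IsLinear K (F.space S) (F.space T) (F.linearExtension h)
  linearExtension-linear {S = S} {T} h = mkLinear (F.space S) (F.space T)
    (λ {u} {v} u≈v → subst₂ F._≈_ (sym (linearExtension≡extend h u)) (sym (linearExtension≡extend h v))
                       (extend-cong (F.space T) h u≈v))
    (λ _ _ → F.≈-refl) (λ _ _ → F.≈-refl)

  -- For fixed `u` the map is a combination of the maps `h s` with the coefficients of `u`, and
  -- linear maps are closed under such combinations. This gives linearity of the product in its
  -- second factor.
  linearExtension-linear-in-map :
    ∀ {s t v ℓv} {S : Set s} {T : Set t} (V : Module (scalars K) v ℓv)
    {h : S → Module.Carrierᴹ V → K[_] K T} → (∀ s → IsLinear K V (F.space T) (h s)) →
    ∀ u → IsLinear K V (F.space T) (λ w → F.linearExtension (λ s → h s w) u)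
  linearExtension-linear-in-map {T = T} V {h} h-linear = go
    where
    go : ∀ u → IsLinear K V (F.space T) (λ w → F.linearExtension (λ s → h s w) u)
    go [ s ]   = h-linear s
    go 𝟎       = zero-linear V (F.space T)
    go (u ⊕ v) = +-linear V (F.space T) (go u) (go v)
    go (⊖ u)   = -‿linear V (F.space T) (go u)
    go (k · u) = *-linear V (F.space T) (go u) k

  module _ {s t w} {S : Set s} {T : Set t} {W : Set w} (h : S → T → W) where

    bilinearExtension-linearˡ : ∀ v → IsLinear K (F.space S) (F.space W) (λ u → F.bilinearExtension h u v)
    bilinearExtension-linearˡ v = linearExtension-linear _

    bilinearExtension-linearʳ : ∀ u → IsLinear K (F.space T) (F.space W) (F.bilinearExtension h u)
    bilinearExtension-linearʳ = linearExtension-linear-in-map (F.space T) (λ s → linearExtension-linear _)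

-- Sequences as lists

-- The list counterpart of `insert`. Lists have no length index, so the casts disappear and
-- associativity becomes an equation within one type.
splice : ∀ {a} {A : Set a} → ℕ → List A → List A → List A
splice zero    f g       = f ++ g
-- Default value: an index past the end puts `f` last.
splice (suc i) f []      = f
splice (suc i) f (y ∷ g) = y ∷ splice i f g

module _ {a} {A : Set a} where

  splice-++ : ∀ {i} (f g h : List A) → i ≤ length g →
              splice i f g ++ h ≡ splice i f (g ++ h)
  splice-++ {zero}  f g       h _         = ++-assoc f g h
  splice-++ {suc i} f (y ∷ g) h (s≤s i≤g) = cong (y ∷_) (splice-++ f g h i≤g)

  -- Induction on `j` strips letters of `h` from the front of both sides, each of them moving `f`
  -- one place to the right. At `j = 0` it remains to append `h` behind `g`, which does not disturb
  -- an insertion into `g`.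
  splice-assoc : ∀ {i j} (f g h : List A) → i ≤ length g → j ≤ length h →
                 splice j (splice i f g) h ≡ splice (i + j) f (splice j g h)
  splice-assoc {i} {zero}  f g h       i≤g _         rewrite +-identityʳ i = splice-++ f g h i≤g
  splice-assoc {i} {suc j} f g (y ∷ h) i≤g (s≤s j≤h) rewrite +-suc i j =
    cong (y ∷_) (splice-assoc f g h i≤g j≤h)

  length-splice : ∀ i (f g : List A) → length (splice i f g) ≡ length f + length g
  length-splice zero    f g       = List.length-++ f
  length-splice (suc i) f []      = sym (+-identityʳ _)
  length-splice (suc i) f (y ∷ g) =
    trans (cong suc (length-splice i f g)) (sym (+-suc (length f) (length g)))

map-splice : ∀ {a b} {A : Set a} {B : Set b} (h : A → B) i (f g : List A) →
             map h (splice i f g) ≡ splice i (map h f) (map h g)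
map-splice h zero    f g       = map-++ h f g
map-splice h (suc i) f []      = refl
map-splice h (suc i) f (y ∷ g) = cong (h y ∷_) (map-splice h i f g)

toList-insert : ∀ {a} {A : Set a} {n m} i .(i≤m : i ≤ m) (f : Vec A n) (g : Vec A m) →
                toList (insert i i≤m f g) ≡ splice i (toList f) (toList g)
toList-insert zero    _   f g       = Vec.toList-++ f g
toList-insert {n = n} {suc m} (suc i) i≤m f (y ∷ g) =
  trans (Vec.toList-cast (sym (+-suc n m)) (y ∷ insert i (s≤s⁻¹ i≤m) f g))
        (cong (y ∷_) (toList-insert i (s≤s⁻¹ i≤m) f g))

values-list : ∀ {n r} → Vec (Fin r) n → List ℕ
values-list f = map toℕ (toList f)

-- The number `r` is an argument because a list of naturals does not carry the bound on its letters.
shuffle-list : ℕ → ℕ → List ℕ → List ℕ → List ℕ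
shuffle-list r i f g = splice i f (map (r +_) g)

length-values-list : ∀ {n r} (f : Vec (Fin r) n) → length (values-list f) ≡ n
length-values-list f = trans (length-map toℕ (toList f)) (Vec.length-toList f)

-- Under `toℕ` the injection `↑ˡ` becomes the identity and `↑ʳ` becomes `r +_`, so only the second
-- word is shifted.
values-list-shuffle : ∀ {n m r k} i .(i≤m : i ≤ m) (f : Vec (Fin r) n) (g : Vec (Fin k) m) →
  values-list (shuffle i i≤m f g) ≡ shuffle-list r i (values-list f) (values-list g)
values-list-shuffle {r = r} {k} i i≤m f g = begin
  map toℕ (toList (insert i i≤m (Vec.map (Fin._↑ˡ k) f) (Vec.map (r Fin.↑ʳ_) g)))
    ≡⟨ cong (map toℕ) (toList-insert i i≤m _ _) ⟩
  map toℕ (splice i (toList (Vec.map (Fin._↑ˡ k) f)) (toList (Vec.map (r Fin.↑ʳ_) g)))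
    ≡⟨ map-splice toℕ i _ _ ⟩
  splice i (map toℕ (toList (Vec.map (Fin._↑ˡ k) f))) (map toℕ (toList (Vec.map (r Fin.↑ʳ_) g)))
    ≡⟨ cong₂ (splice i) (values-map (Fin._↑ˡ k) id (λ l → Fin.toℕ-↑ˡ l k) f)
                        (values-map (r Fin.↑ʳ_) (r +_) (Fin.toℕ-↑ʳ r) g) ⟩
  splice i (map id (values-list f)) (map (r +_) (values-list g))
    ≡⟨ cong (λ e → splice i e (map (r +_) (values-list g))) (List.map-id (values-list f)) ⟩
  splice i (values-list f) (map (r +_) (values-list g)) ∎
  where
  open ≡-Reasoning
  values-map : ∀ {n r s} (h : Fin r → Fin s) (h′ : ℕ → ℕ) → (∀ l → toℕ (h l) ≡ h′ (toℕ l)) →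
               (f : Vec (Fin r) n) → map toℕ (toList (Vec.map h f)) ≡ map h′ (values-list f)
  values-map h h′ e []      = refl
  values-map h h′ e (l ∷ f) = cong₂ _∷_ (e l) (values-map h h′ e f)

-- Given `splice-assoc`, it remains that shifting by `r + k` is shifting by `k` and then by `r`, and
-- that a shift commutes with `splice`.
shuffle-list-assoc : ∀ r k {i j} f g h → i ≤ length g → j ≤ length h →
  shuffle-list (r + k) j (shuffle-list r i f g) h ≡ shuffle-list r (i + j) f (shuffle-list k j g h)
shuffle-list-assoc r k {i} {j} f g h i≤g j≤h = begin
  splice j (splice i f (map (r +_) g)) (map (r + k +_) h)
    ≡⟨ splice-assoc f (map (r +_) g) _ (subst (i ≤_) (sym (length-map _ g)) i≤g)
                                       (subst (j ≤_) (sym (length-map _ h)) j≤h) ⟩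
  splice (i + j) f (splice j (map (r +_) g) (map (r + k +_) h))
    ≡⟨ cong (splice (i + j) f ∘ splice j (map (r +_) g))
            (trans (map-cong (+-assoc r k) h) (map-∘ h)) ⟩
  splice (i + j) f (splice j (map (r +_) g) (map (r +_) (map (k +_) h)))
    ≡⟨ cong (splice (i + j) f) (map-splice (r +_) j g _) ⟨
  splice (i + j) f (map (r +_) (splice j g (map (k +_) h))) ∎
  where open ≡-Reasoning

-- Peak-free lists and the block of zeros

firstZero : List ℕ → ℕ
firstZero []          = 0
firstZero (zero  ∷ f) = 0
firstZero (suc _ ∷ f) = suc (firstZero f)

-- Lowering the surviving letters undoes the shift in `shuffle-list 1`, so the second factor of the
-- decomposition is recovered.
nonzeros : List ℕ → List ℕ
nonzeros []          = []
nonzeros (zero  ∷ f) = nonzeros f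
nonzeros (suc a ∷ f) = a ∷ nonzeros f

-- The list counterpart of `fibreSize`. With the boolean test, `suc a ≡ᵇ suc l` reduces to `a ≡ᵇ l`,
-- so lowering all letters costs no argument.
occurrences : ℕ → List ℕ → ℕ
occurrences l []      = 0
occurrences l (a ∷ f) = if a ≡ᵇ l then suc (occurrences l f) else occurrences l f

zeros : ℕ → List ℕ
zeros d = replicate d 0

firstZero≤ : ∀ f → firstZero f ≤ length (nonzeros f)
firstZero≤ []          = z≤n
firstZero≤ (zero  ∷ f) = z≤n
firstZero≤ (suc _ ∷ f) = s≤s (firstZero≤ f)

-- Shifted letters are positive, so the first zero is the head of the block; writing the length as
-- `suc d` ensures that there is one.
firstZero-block : ∀ {i} d g → i ≤ length g → firstZero (shuffle-list 1 i (zeros (suc d)) g) ≡ i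
firstZero-block {zero}  d g       _         = refl
firstZero-block {suc i} d (_ ∷ g) (s≤s i≤g) = cong suc (firstZero-block d g i≤g)

nonzeros-block : ∀ {i} d g → i ≤ length g → nonzeros (shuffle-list 1 i (zeros d) g) ≡ g
nonzeros-block {zero}  (suc d) g       _         = nonzeros-block d g z≤n
nonzeros-block {zero}  zero    []      _         = refl
nonzeros-block {zero}  zero    (a ∷ g) _         = cong (a ∷_) (nonzeros-block zero g z≤n)
nonzeros-block {suc i} d       (a ∷ g) (s≤s i≤g) = cong (a ∷_) (nonzeros-block d g i≤g)

occurrences-nonzeros : ∀ l f → occurrences l (nonzeros f) ≡ occurrences (suc l) f
occurrences-nonzeros l []          = refl
occurrences-nonzeros l (zero  ∷ f) = occurrences-nonzeros l f
occurrences-nonzeros l (suc a ∷ f) =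
  cong (λ o → if a ≡ᵇ l then suc o else o) (occurrences-nonzeros l f)

∈-nonzeros : ∀ {a} f → a ∈ nonzeros f → suc a ∈ f
∈-nonzeros (zero  ∷ f) p         = there (∈-nonzeros f p)
∈-nonzeros (suc a ∷ f) (here e)  = here (cong suc e)
∈-nonzeros (suc a ∷ f) (there p) = there (∈-nonzeros f p)

All-nonzeros : ∀ {r} f → All (_< suc r) f → All (_< r) (nonzeros f)
All-nonzeros []          []       = []
All-nonzeros (zero  ∷ f) (_ ∷ ps) = All-nonzeros f ps
All-nonzeros (suc a ∷ f) (p ∷ ps) = s≤s⁻¹ p ∷ All-nonzeros f ps

-- The letters before the last occurrence of a are at most a.
data Dominates (a : ℕ) : List ℕ → Set where
  []  : Dominates a []
  _∷_ : ∀ {c f} → (a ∈ c ∷ f → c ≤ a) → Dominates a f → Dominates a (c ∷ f)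

-- The list form of `NoPeaks`, taken tail by tail: dominance by the head is the condition for
-- `i = 0`, and all other pairs lie in the tail.
data PeakFree : List ℕ → Set where
  []  : PeakFree []
  _∷_ : ∀ {a f} → Dominates a f → PeakFree f → PeakFree (a ∷ f)

Dominates-nonzeros : ∀ {a} f → Dominates (suc a) f → Dominates a (nonzeros f)
Dominates-nonzeros []          []       = []
Dominates-nonzeros (zero  ∷ f) (_ ∷ d) = Dominates-nonzeros f d
Dominates-nonzeros (suc c ∷ f) (p ∷ d) =
  (s≤s⁻¹ ∘ p ∘ ∈-nonzeros (suc c ∷ f)) ∷ Dominates-nonzeros f d

PeakFree-nonzeros : ∀ f → PeakFree f → PeakFree (nonzeros f)
PeakFree-nonzeros []          []      = []
PeakFree-nonzeros (zero  ∷ f) (_ ∷ p) = PeakFree-nonzeros f p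
PeakFree-nonzeros (suc a ∷ f) (d ∷ p) = Dominates-nonzeros f d ∷ PeakFree-nonzeros f p

no-zeros : ∀ f → ¬ 0 ∈ f → occurrences 0 f ≡ 0 × f ≡ map suc (nonzeros f)
no-zeros []          _  = refl , refl
no-zeros (zero  ∷ f) ∉f = contradiction (here refl) ∉f
no-zeros (suc a ∷ f) ∉f with no-zeros f (∉f ∘ there)
... | e , e′ = e , cong (suc a ∷_) e′

-- In the tail after a zero, a positive letter cannot precede another zero, since it would have to
-- be at most 0. Hence the zeros come first, without a gap.
zeros-first : ∀ f → Dominates 0 f → f ≡ zeros (occurrences 0 f) ++ map suc (nonzeros f)
zeros-first []          []      = refl
zeros-first (zero  ∷ f) (_ ∷ d) = cong (0 ∷_) (zeros-first f d)
zeros-first (suc a ∷ f) (p ∷ _) with no-zeros (suc a ∷ f) (λ 0∈ → contradiction (p 0∈) λ ())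
... | e , e′ rewrite e = e′

-- The letters before the first zero are copied on both sides; the first zero supplies the
-- hypothesis of `zeros-first` for the rest.
zeros-block : ∀ f → PeakFree f →
              f ≡ shuffle-list 1 (firstZero f) (zeros (occurrences 0 f)) (nonzeros f)
zeros-block []          []      = refl
zeros-block (zero  ∷ f) (d ∷ _) = cong (0 ∷_) (zeros-first f d)
zeros-block (suc a ∷ f) (_ ∷ p) = cong (suc a ∷_) (zeros-block f p)

values<r : ∀ {n r} (f : Vec (Fin r) n) → All (_< r) (values-list f)
values<r []      = []
values<r (l ∷ f) = Fin.toℕ<n l ∷ values<r f

occurrences-values-list : ∀ {n r} (f : Vec (Fin r) n) l → occurrences (toℕ l) (values-list f) ≡ fibreSize f l
occurrences-values-list []      l = refl
occurrences-values-list (a ∷ f) l with does (a Fin.≟ l) | toℕ a ≡ᵇ toℕ l | does-≟ a l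
  where
  does-≟ : ∀ {r} (a l : Fin r) → does (a Fin.≟ l) ≡ (toℕ a ≡ᵇ toℕ l)
  does-≟ zero    zero    = refl
  does-≟ zero    (suc _) = refl
  does-≟ (suc _) zero    = refl
  does-≟ (suc a) (suc l) = does-≟ a l
... | true  | _ | refl = cong suc (occurrences-values-list f l)
... | false | _ | refl = occurrences-values-list f l

∈-values-list : ∀ {n r a} (f : Vec (Fin r) n) → a ∈ values-list f → ∃ λ j → a ≡ toℕ (Vec.lookup f j)
∈-values-list (l ∷ f) (here e)  = zero , e
∈-values-list (l ∷ f) (there p) with ∈-values-list f p
... | j , e = suc j , e

noPeaks⇒PeakFree : ∀ {n r} (f : Vec (Fin r) n) → NoPeaks f → PeakFree (values-list f)
noPeaks⇒PeakFree []      _  = []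
noPeaks⇒PeakFree (a ∷ f) np =
  dominates f (λ j k e k≤j → np zero (suc j) (suc k) (s≤s z≤n) (sym e) z≤n (s≤s k≤j))
  ∷ noPeaks⇒PeakFree f (λ i j k i<j e i≤k k≤j → np (suc i) (suc j) (suc k) (s≤s i<j) e (s≤s i≤k) (s≤s k≤j))
  where
  dominates : ∀ {n} (f : Vec (Fin _) n) →
              (∀ j k → Vec.lookup f j ≡ a → k Fin.≤ j → Vec.lookup f k Fin.≤ a) →
              Dominates (toℕ a) (values-list f)
  dominates []      _ = []
  dominates (c ∷ f) H =
    (λ a∈ → let j , e = ∈-values-list (c ∷ f) a∈ in H j zero (Fin.toℕ-injective (sym e)) z≤n)
    ∷ dominates f (λ j k e k≤j → H (suc j) (suc k) e (s≤s k≤j))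

-- Universal property

module Heterogeneous {c ℓ₁ ℓ₂ a ℓa} (K : HeytingField c ℓ₁ ℓ₂) (A : GradedSpace K a ℓa) where

  private module A n = Module (A n)

  infix 4 _≋_
  -- Equality of homogeneous elements whose degrees are only propositionally equal.
  data _≋_ {n} (x : ∣_∣ K A n) : ∀ {m} → ∣_∣ K A m → Set (a ⊔ ℓa) where
    ≈⇒≋ : ∀ {y} → Module._≈ᴹ_ (A n) x y → x ≋ y

  ≋⇒≡ : ∀ {n m} {x : ∣_∣ K A n} {y : ∣_∣ K A m} → x ≋ y → n ≡ m
  ≋⇒≡ (≈⇒≋ _) = refl

  -- Leads back to the transported form in which the associativity law is stated.
  ≋⇒subst-≈ : ∀ {n m} {x : ∣_∣ K A n} {y : ∣_∣ K A m} → x ≋ y → (e : n ≡ m) →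
              Module._≈ᴹ_ (A m) (subst (∣_∣ K A) e x) y
  ≋⇒subst-≈ (≈⇒≋ p) refl = p

  ≋⇒≈ : ∀ {n} {x y : ∣_∣ K A n} → x ≋ y → Module._≈ᴹ_ (A n) x y
  ≋⇒≈ p = ≋⇒subst-≈ p refl

  subst-≋ : ∀ {n m} (e : n ≡ m) (x : ∣_∣ K A n) → subst (∣_∣ K A) e x ≋ x
  subst-≋ {n} refl x = ≈⇒≋ (A.≈ᴹ-refl n)

  ≋-reflexive : ∀ {n} {x y : ∣_∣ K A n} → x ≡ y → x ≋ y
  ≋-reflexive {n} e = ≈⇒≋ (A.≈ᴹ-reflexive n e)

  ≋-sym : ∀ {n m} {x : ∣_∣ K A n} {y : ∣_∣ K A m} → x ≋ y → y ≋ x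
  ≋-sym {n} (≈⇒≋ p) = ≈⇒≋ (A.≈ᴹ-sym n p)

  ≋-trans : ∀ {n m p} {x : ∣_∣ K A n} {y : ∣_∣ K A m} {z : ∣_∣ K A p} → x ≋ y → y ≋ z → x ≋ z
  ≋-trans {n} (≈⇒≋ p) (≈⇒≋ q) = ≈⇒≋ (A.≈ᴹ-trans n p q)

-- Block decompositions

module _ {s} {C : ℕ → Set s} where

  -- The products (ξ_d; x₁) •ᵢ ((ξ_e; x₂) •ⱼ …), with an empty product as the base case.
  data Blocks : List (Σ ℕ C) → List ℕ → Set s where
    []    : Blocks [] []
    block : ∀ {d x xs g i} → i ≤ length g → Blocks xs g →
            Blocks ((d , x) ∷ xs) (shuffle-list 1 i (zeros d) g)

  -- Each label uses up the current block of zeros. What is left has one value fewer, and by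
  -- `occurrences-nonzeros` its fibre sizes are those of the remaining labels.
  blocks : ∀ {r} (xs : Vec (Σ ℕ C) r) f → All (_< r) f → .(PeakFree f) →
           (∀ l → proj₁ (Vec.lookup xs l) ≡ occurrences (toℕ l) f) → Blocks (toList xs) f
  blocks []             []      _        _  _ = []
  blocks []             (_ ∷ _) (() ∷ _) _  _
  -- The degree of the first label counts the zeros, so matching turns `d` into the length of the
  -- block.
  blocks ((d , x) ∷ xs) f       f<r      pf degree with refl ← degree zero =
    -- Peak-freeness is available only irrelevantly; the equation it yields is recovered because
    -- equality of lists of numbers is decidable.
    subst (Blocks _) (sym (recompute (≡-dec _≟_ _ _) (zeros-block f pf)))
      (block (firstZero≤ f)
        (blocks xs (nonzeros f) (All-nonzeros f f<r) (PeakFree-nonzeros f pf)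
                (λ l → trans (degree (suc l)) (sym (occurrences-nonzeros (toℕ l) f)))))

  -- The sum is bracketed to the right and ends in `d` rather than `d + 0`, as the degree of an
  -- iterated product does, so `build` and `evaluate` need no transport.
  deg : Σ ℕ C → List (Σ ℕ C) → ℕ
  deg (d , _) []       = d
  deg (d , _) (y ∷ ys) = d + deg y ys

  length-Blocks : ∀ {x xs f} → Blocks (x ∷ xs) f → length f ≡ deg x xs
  length-Blocks {d , _} (block {g = g} {i} _ b) = trans (length-splice i (zeros d) (map suc g))
    (trans (cong₂ _+_ (List.length-replicate d) (List.length-map suc g)) (rest b))
    where
    rest : ∀ {xs g} → Blocks xs g → d + length g ≡ deg (d , _) xs
    rest []            = +-identityʳ d
    rest b@(block _ _) = cong (d +_) (length-Blocks b)

  ≤-deg : ∀ {x xs f i} → Blocks (x ∷ xs) f → i ≤ length f → i ≤ deg x xs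
  ≤-deg {i = i} b = subst (i ≤_) (length-Blocks b)

  ≤-length : ∀ {x xs f i} → Blocks (x ∷ xs) f → i ≤ deg x xs → i ≤ length f
  ≤-length {i = i} b = subst (i ≤_) (sym (length-Blocks b))

-- Basis elements as pairs of lists

module _ {s} {X : PositivelyGradedSet s} where

  labelList : ∀ {n} → 𝒦[ X ] n → List (Total X)
  labelList u = toList (𝒦[_].labels u)

  letters : ∀ {n} → 𝒦[ X ] n → List ℕ
  letters u = values-list (𝒦.values (𝒦[_].map-of u))

  length-letters : ∀ {n} (u : 𝒦[ X ] n) → length (letters u) ≡ n
  length-letters u = length-values-list (𝒦.values (𝒦[_].map-of u))

  decompose : ∀ {n} (u : 𝒦[ X ] n) → Blocks (labelList u) (letters u)
  decompose (mk (mk𝒦 _ _ f _ np) xs degree) =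
    blocks xs (values-list f) (values<r f) (noPeaks⇒PeakFree f np)
           (λ l → trans (recompute (_ ≟ _) (degree l)) (sym (occurrences-values-list f l)))

  -- There is no unit to serve as an empty product, so the recursions below need a first label;
  -- `1 ≤ r` provides it.
  labelList-nonempty : ∀ {n} (u : 𝒦[ X ] n) → ∃₂ λ x xs → labelList u ≡ x ∷ xs
  labelList-nonempty (mk (mk𝒦 {zero}  () _ _ _ _) _        _)
  labelList-nonempty (mk (mk𝒦 {suc _} _  _ _ _ _) (x ∷ xs) _) = x , toList xs , refl

  labelList-• : ∀ {n m} (u : 𝒦[ X ] n) i .(i≤m : i ≤ m) (v : 𝒦[ X ] m) →
                labelList (u •ᴷ[ i , i≤m ] v) ≡ labelList u ++ labelList v
  labelList-• (mk _ xs _) i i≤m (mk _ ys _) = Vec.toList-++ xs ys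

  letters-• : ∀ {n m} (u : 𝒦[ X ] n) i .(i≤m : i ≤ m) (v : 𝒦[ X ] m) →
              letters (u •ᴷ[ i , i≤m ] v) ≡
              shuffle-list (length (labelList u)) i (letters u) (letters v)
  letters-• (mk (mk𝒦 _ _ f _ _) xs _) i i≤m (mk (mk𝒦 _ _ g _ _) _ _) =
    trans (values-list-shuffle i i≤m f g)
          (cong (λ r → shuffle-list r i (values-list f) (values-list g)) (sym (Vec.length-toList xs)))

  letters-ξ : ∀ {n} (x : component X n) → letters ξ[ x ] ≡ zeros n
  letters-ξ {n} x = trans (cong (map toℕ) (Vec.toList-replicate n zero)) (List.map-replicate toℕ n zero)

  values-list-injective : ∀ {n r} (f g : Vec (Fin r) n) → values-list f ≡ values-list g → f ≡ g
  values-list-injective []      []      _ = refl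
  values-list-injective (a ∷ f) (b ∷ g) e =
    cong₂ _∷_ (Fin.toℕ-injective (List.∷-injectiveˡ e)) (values-list-injective f g (List.∷-injectiveʳ e))

  toList-injective : ∀ {b n} {B : Set b} (xs ys : Vec B n) → toList xs ≡ toList ys → xs ≡ ys
  toList-injective xs ys e = trans (sym (Vec.cast-is-id refl xs)) (Vec.toList-injective refl xs ys e)

  -- The length of the label list determines the number of values; once these are identified the
  -- vectors agree, and the remaining fields are irrelevant.
  𝒦-ext : ∀ {n} (u v : 𝒦[ X ] n) → labelList u ≡ labelList v → letters u ≡ letters v → u ≡ v
  𝒦-ext (mk (mk𝒦 {r} _ _ f _ _) xs _) (mk (mk𝒦 {k} _ _ g _ _) ys _) e e′
    with refl ← trans (sym (Vec.length-toList xs)) (trans (cong length e) (Vec.length-toList ys))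
    with refl ← toList-injective xs ys e | refl ← values-list-injective f g e′ = refl

  -- With the next two lemmas and `𝒦-ext`, this exhibits every basis element as an iterated product
  -- of generators.
  build : ∀ {x xs f} → Blocks (x ∷ xs) f → 𝒦[ X ] (deg x xs)
  build {_ , x} {[]}    (block _ _)         = ξ[ x ]
  build {_ , x} {_ ∷ _} (block {i = i} i≤g b) =
    ξ[ x ] •ᴷ[ i , ≤-deg b i≤g ] build b

  labelList-build : ∀ {x xs f} (b : Blocks (x ∷ xs) f) → labelList (build b) ≡ x ∷ xs
  labelList-build {_ , x} {[]}    (block _ _)           = refl
  labelList-build {_ , x} {_ ∷ _} (block {i = i} i≤g b) =
    trans (labelList-• ξ[ x ] i (≤-deg b i≤g) (build b)) (cong (_ ∷_) (labelList-build b))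

  letters-build : ∀ {x xs f} (b : Blocks (x ∷ xs) f) → letters (build b) ≡ f
  letters-build {_ , x} {[]}    (block z≤n [])        = trans (letters-ξ x) (sym (++-identityʳ _))
  letters-build {_ , x} {_ ∷ _} (block {i = i} i≤g b) =
    trans (letters-• ξ[ x ] i (≤-deg b i≤g) (build b)) (cong₂ (shuffle-list 1 i) (letters-ξ x) (letters-build b))

-- The preshuffle structure on the free space

module FreeAlgebra {c ℓ₁ ℓ₂ s} (K : HeytingField c ℓ₁ ℓ₂) (X : PositivelyGradedSet s) where

  open module F = FreeSpace K using ([_])

  private
    V : GradedSpace K (c ⊔ s) (c ⊔ ℓ₁ ⊔ s)
    V = K[𝒦∞] K X

    open module V≋ = Heterogeneous K V using () renaming (_≋_ to _≋ᴷ_)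

  -- The degree is the length of the word, so equal words have equal degrees and `𝒦-ext` becomes
  -- applicable.
  []-≋ : ∀ {n m} (u : 𝒦[ X ] n) (v : 𝒦[ X ] m) →
         labelList u ≡ labelList v → letters u ≡ letters v → [ u ] ≋ᴷ [ v ]
  []-≋ u v e e′ with refl ← trans (sym (length-letters u)) (trans (cong length e′) (length-letters v)) =
    V≋.≈⇒≋ (subst (λ w → [ u ] F.≈ [ w ]) (𝒦-ext u v e e′) F.≈-refl)

  •ᴷ-assoc : ∀ {n m p i j} (i≤m : i ≤ m) (j≤p : j ≤ p) (u : 𝒦[ X ] n) (v : 𝒦[ X ] m) (w : 𝒦[ X ] p) →
             [ (u •ᴷ[ i , i≤m ] v) •ᴷ[ j , j≤p ] w ] ≋ᴷ
             [ u •ᴷ[ i + j , ℕ.+-mono-≤ i≤m j≤p ] (v •ᴷ[ j , j≤p ] w) ]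
  •ᴷ-assoc {i = i} {j} i≤m j≤p u v w = []-≋ _ _
    (begin
      labelList ((u •ᴷ[ i , i≤m ] v) •ᴷ[ j , j≤p ] w)
        ≡⟨ trans (labelList-• (u •ᴷ[ i , i≤m ] v) j j≤p w) (cong (_++ labelList w) (labelList-• u i i≤m v)) ⟩
      (labelList u ++ labelList v) ++ labelList w
        ≡⟨ ++-assoc (labelList u) (labelList v) (labelList w) ⟩
      labelList u ++ labelList v ++ labelList w
        ≡⟨ trans (labelList-• u (i + j) i+j≤m+p (v •ᴷ[ j , j≤p ] w)) (cong (labelList u ++_) (labelList-• v j j≤p w)) ⟨
      labelList (u •ᴷ[ i + j , i+j≤m+p ] (v •ᴷ[ j , j≤p ] w)) ∎)
    (begin
      letters ((u •ᴷ[ i , i≤m ] v) •ᴷ[ j , j≤p ] w)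
        ≡⟨ letters-• (u •ᴷ[ i , i≤m ] v) j j≤p w ⟩
      shuffle-list (length (labelList (u •ᴷ[ i , i≤m ] v))) j (letters (u •ᴷ[ i , i≤m ] v)) (letters w)
        ≡⟨ cong₂ (λ r f → shuffle-list r j f (letters w))
             (trans (cong length (labelList-• u i i≤m v)) (List.length-++ (labelList u)))
             (letters-• u i i≤m v) ⟩
      shuffle-list (length (labelList u) + length (labelList v)) j
        (shuffle-list (length (labelList u)) i (letters u) (letters v)) (letters w)
        ≡⟨ shuffle-list-assoc (length (labelList u)) (length (labelList v)) (letters u) (letters v) (letters w)
             (subst (i ≤_) (sym (length-letters v)) i≤m) (subst (j ≤_) (sym (length-letters w)) j≤p) ⟩
      shuffle-list (length (labelList u)) (i + j) (letters u)
        (shuffle-list (length (labelList v)) j (letters v) (letters w))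
        ≡⟨ trans (letters-• u (i + j) i+j≤m+p (v •ᴷ[ j , j≤p ] w))
             (cong (shuffle-list (length (labelList u)) (i + j) (letters u)) (letters-• v j j≤p w)) ⟨
      letters (u •ᴷ[ i + j , i+j≤m+p ] (v •ᴷ[ j , j≤p ] w)) ∎)
    where
    open ≡-Reasoning
    i+j≤m+p = ℕ.+-mono-≤ i≤m j≤p

  •-linearˡ : ∀ {n m i} (i≤m : i ≤ m) (v : ∣_∣ K V m) →
              IsLinear K (V n) (V (n + m)) (λ u → shuffleOps K X u i i≤m v)
  •-linearˡ {i = i} i≤m = bilinearExtension-linearˡ K (λ u v → u •ᴷ[ i , i≤m ] v)

  •-linearʳ : ∀ {n m i} (i≤m : i ≤ m) (u : ∣_∣ K V n) →
              IsLinear K (V m) (V (n + m)) (λ v → shuffleOps K X u i i≤m v)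
  •-linearʳ {i = i} i≤m = bilinearExtension-linearʳ K (λ u v → u •ᴷ[ i , i≤m ] v)

  isPreshuffleAlgebra : IsPreshuffleAlgebra K V (shuffleOps K X)
  isPreshuffleAlgebra = record
    { linearˡ = •-linearˡ
    ; linearʳ = •-linearʳ
    ; assoc   = λ {n} {m} {p} {i} {j} i≤m j≤p x y z →
        let W  = V (n + (m + p))
            i+j≤m+p = ℕ.+-mono-≤ i≤m j≤p
            transport = subst-linear K V (+-assoc n m p)
        in
        -- Both sides are linear in each argument, so `x`, `y` and `z` are replaced by basis
        -- elements one after another.
        linear-unique K W
          (∘-linear K (V n) (V (n + m)) W (•-linearˡ i≤m y)
            (∘-linear K (V (n + m)) (V (n + m + p)) W (•-linearˡ j≤p z) transport))
          (•-linearˡ i+j≤m+p (shuffleOps K X y j j≤p z))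
          (λ u → linear-unique K W
            (∘-linear K (V m) (V (n + m)) W (•-linearʳ i≤m [ u ])
              (∘-linear K (V (n + m)) (V (n + m + p)) W (•-linearˡ j≤p z) transport))
            (∘-linear K (V m) (V (m + p)) W (•-linearˡ j≤p z) (•-linearʳ i+j≤m+p [ u ]))
            (λ v → linear-unique K W
              (∘-linear K (V p) (V (n + m + p)) W (•-linearʳ j≤p [ u •ᴷ[ i , i≤m ] v ]) transport)
              (∘-linear K (V p) (V (m + p)) W (•-linearʳ j≤p [ v ]) (•-linearʳ i+j≤m+p [ u ]))
              (λ w → V≋.≋⇒subst-≈ (•ᴷ-assoc i≤m j≤p u v w) (+-assoc n m p))
              z)
            y)
          x
    }

  -- The induced homomorphism and its uniqueness

  module Universal {a ℓa} (𝒜 : PreshuffleAlgebra K a ℓa)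
                   (φ : ∀ n → component X n → ∣_∣ K (PreshuffleAlgebra.space 𝒜) n) where

    private
      A : GradedSpace K a ℓa
      A = PreshuffleAlgebra.space 𝒜

      module A n = Module (A n)
      open IsPreshuffleAlgebra (PreshuffleAlgebra.isPreshuffleAlgebra 𝒜)

      infix 8 _•[_,_]_
      _•[_,_]_ : Operations K A
      _•[_,_]_ = PreshuffleAlgebra.ops 𝒜

      open module A≋ = Heterogeneous K A

    -- The bounds are irrelevant arguments, so after matching only the congruence contained in
    -- linearity is needed.
    •-cong : ∀ {n n′ m m′ i i′} {x : ∣_∣ K A n} {x′ : ∣_∣ K A n′} {y : ∣_∣ K A m} {y′ : ∣_∣ K A m′}
             (i≤m : i ≤ m) (i′≤m′ : i′ ≤ m′) → x ≋ x′ → i ≡ i′ → y ≋ y′ →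
             x •[ i , i≤m ] y ≋ x′ •[ i′ , i′≤m′ ] y′
    •-cong {n} {m = m} {x′ = x′} {y} i≤m _ (≈⇒≋ p) refl (≈⇒≋ q) =
      ≈⇒≋ (A.≈ᴹ-trans (n + m) (IsModuleHomomorphism.⟦⟧-cong (linearˡ i≤m y) p)
                              (IsModuleHomomorphism.⟦⟧-cong (linearʳ i≤m x′) q))

    •-assoc : ∀ {n m p i j} (i≤m : i ≤ m) (j≤p : j ≤ p) (x : ∣_∣ K A n) (y : ∣_∣ K A m) (z : ∣_∣ K A p) →
              (x •[ i , i≤m ] y) •[ j , j≤p ] z ≋ x •[ i + j , ℕ.+-mono-≤ i≤m j≤p ] (y •[ j , j≤p ] z)
    •-assoc {n} {m} {p} i≤m j≤p x y z =
      ≋-trans (≋-sym (subst-≋ (+-assoc n m p) _)) (≈⇒≋ (assoc i≤m j≤p x y z))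

    -- The truncation of the index has no effect when Blocks (x ∷ xs) f holds; it makes the product defined for all f.
    evaluate : ∀ x xs → List ℕ → ∣_∣ K A (deg x xs)
    evaluate (d , x) []       f = φ d x
    evaluate (d , x) (y ∷ ys) f =
      φ d x •[ firstZero f ⊓ deg y ys , m⊓n≤n (firstZero f) (deg y ys) ] evaluate y ys (nonzeros f)

    -- The word determines `i` and `g`, by `firstZero-block` and `nonzeros-block`. The second factor
    -- is any `w` equal to the evaluation, possibly in another form of the degree, so that
    -- `evaluate-•` can insert its induction hypothesis.
    evaluate-block : ∀ {d i m g} {w : ∣_∣ K A m} (x : component X d) y ys (i≤m : i ≤ m) → i ≤ length g →
                     evaluate y ys g ≋ w →
                     evaluate (d , x) (y ∷ ys) (shuffle-list 1 i (zeros d) g) ≋ φ d x •[ i , i≤m ] w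
    -- An empty block would leave no trace of `i` in the word; positivity of the grading excludes
    -- it.
    evaluate-block {zero} x _ _ with () ← positive X x
    evaluate-block {suc d} {i} {g = g} x y ys i≤m i≤g e =
      •-cong (m⊓n≤n (firstZero (shuffle-list 1 i (zeros (suc d)) g)) (deg y ys)) i≤m (≋-reflexive refl)
        (trans (cong (_⊓ deg y ys) (firstZero-block d g i≤g))
               (m≤n⇒m⊓n≡m (subst (i ≤_) (sym (≋⇒≡ e)) i≤m)))
        (≋-trans (≋-reflexive (cong (evaluate y ys) (nonzeros-block (suc d) g i≤g))) e)

    -- Induction on the blocks of the first factor. Associativity of words brings its first block to
    -- the front, at index `j + i`; associativity in `A`, read backwards, regroups the product after
    -- the induction hypothesis.
    evaluate-• : ∀ {x xs y ys f g i} → Blocks (x ∷ xs) f → Blocks (y ∷ ys) g → (i≤m : i ≤ deg y ys) →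
                 evaluate x (xs ++ y ∷ ys) (shuffle-list (length (x ∷ xs)) i f g) ≋
                 evaluate x xs f •[ i , i≤m ] evaluate y ys g
    -- With a single label the first word is `zeros d ++ []`, so the product is already in block
    -- form.
    evaluate-• {d , x} {[]} {y} {ys} {g = g} {i} (block z≤n []) b i≤m
      rewrite ++-identityʳ (zeros d) =
      evaluate-block x y ys i≤m (≤-length b i≤m) (≋-reflexive refl)
    evaluate-• {d , x} {x′ ∷ xs} {y} {ys} {g = g} {i} (block {g = f} {j} j≤f b) b′ i≤m =
      ≋-trans
        (≋-trans
          (≋-reflexive (cong (evaluate (d , x) (x′ ∷ xs ++ y ∷ ys))
            (shuffle-list-assoc 1 (length (x′ ∷ xs)) (zeros d) f g j≤f i≤g)))
          (evaluate-block x x′ (xs ++ y ∷ ys) (ℕ.+-mono-≤ j≤m i≤m) j+i≤ (evaluate-• b b′ i≤m)))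
        (≋-trans
          (≋-sym (•-assoc j≤m i≤m (φ d x) (evaluate x′ xs f) (evaluate y ys g)))
          (•-cong i≤m i≤m (≋-sym (evaluate-block x x′ xs j≤m j≤f (≋-reflexive refl)))
                  refl (≋-reflexive refl)))
      where
      i≤g : i ≤ length g
      i≤g = ≤-length b′ i≤m
      j≤m : j ≤ deg x′ xs
      j≤m = ≤-deg b j≤f
      j+i≤ : j + i ≤ length (shuffle-list (length (x′ ∷ xs)) i f g)
      j+i≤ = subst (j + i ≤_) (sym (trans (length-splice i f (map (length (x′ ∷ xs) +_) g))
                                          (cong (length f +_) (List.length-map _ g))))
                              (ℕ.+-mono-≤ j≤f i≤g)

    onBasis : ∀ {n} → 𝒦[ X ] n → ∣_∣ K A n
    onBasis u with x , xs , e ← labelList-nonempty u =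
      -- Both `deg x xs` and `n` are the length of the word.
      subst (∣_∣ K A)
        (trans (sym (length-Blocks (subst (λ ys → Blocks ys (letters u)) e (decompose u)))) (length-letters u))
        (evaluate x xs (letters u))

    -- Removes the transport and the particular splitting of the label list chosen in `onBasis`.
    onBasis-evaluate : ∀ {n x xs f} (u : 𝒦[ X ] n) → labelList u ≡ x ∷ xs → letters u ≡ f →
                       onBasis u ≋ evaluate x xs f
    onBasis-evaluate u e refl with labelList-nonempty u
    ... | x , xs , e′ with refl ← trans (sym e) e′ = subst-≋ _ (evaluate x xs (letters u))

    onBasis-• : ∀ {n m i} (i≤m : i ≤ m) (u : 𝒦[ X ] n) (v : 𝒦[ X ] m) →
                onBasis (u •ᴷ[ i , i≤m ] v) ≋ onBasis u •[ i , i≤m ] onBasis v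
    onBasis-• {i = i} i≤m u v =
      let x , xs , e  = labelList-nonempty u
          y , ys , e′ = labelList-nonempty v
          b     = subst (λ zs → Blocks zs (letters v)) e′ (decompose v)
          i≤deg = subst (i ≤_) (trans (sym (length-letters v)) (length-Blocks b)) i≤m
      in
      ≋-trans
        (onBasis-evaluate (u •ᴷ[ i , i≤m ] v)
          (trans (labelList-• u i i≤m v) (cong₂ _++_ e e′))
          (trans (letters-• u i i≤m v)
                 (cong (λ ls → shuffle-list (length ls) i (letters u) (letters v)) e)))
        (≋-trans (evaluate-• (subst (λ zs → Blocks zs (letters u)) e (decompose u)) b i≤deg)
          (•-cong i≤deg i≤m (≋-sym (onBasis-evaluate u e refl)) refl
                            (≋-sym (onBasis-evaluate v e′ refl))))

    Φ : GradedMap K V A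
    Φ n = extend K (A n) onBasis

    Φ-linear : ∀ n → IsLinear K (V n) (A n) (Φ n)
    Φ-linear n = extend-linear K (A n) onBasis

    Φ-isHomomorphism : IsPreshuffleHomomorphism K V A (shuffleOps K X) _•[_,_]_ Φ
    Φ-isHomomorphism = record
      { linear = Φ-linear
      ; homo   = λ {n} {m} i≤m x y →
          linear-unique K (A (n + m))
            (∘-linear K (V n) (V (n + m)) (A (n + m)) (•-linearˡ i≤m y) (Φ-linear (n + m)))
            (∘-linear K (V n) (A n) (A (n + m)) (Φ-linear n) (linearˡ i≤m (Φ m y)))
            (λ u → linear-unique K (A (n + m))
              (∘-linear K (V m) (V (n + m)) (A (n + m)) (•-linearʳ i≤m [ u ]) (Φ-linear (n + m)))
              (∘-linear K (V m) (A m) (A (n + m)) (Φ-linear m) (linearʳ i≤m (onBasis u)))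
              (λ v → ≋⇒≈ (onBasis-• i≤m u v))
              y)
            x
      }

    Extends : GradedMap K V A → Set (s ⊔ ℓa)
    Extends Ψ = ∀ n (x : component X n) → Module._≈ᴹ_ (A n) (Ψ n (generator K X x)) (φ n x)

    -- For a single label `evaluate` returns the value of `φ` whatever the word is.
    Φ-extends : Extends Φ
    Φ-extends n x = ≋⇒≈ (onBasis-evaluate (ξ[_] {X = X} x) refl refl)

    module _ {Ψ : GradedMap K V A} (Ψ-isHom : IsPreshuffleHomomorphism K V A (shuffleOps K X) _•[_,_]_ Ψ)
             (Ψ-extends : Extends Ψ) where

      private module Ψ = IsPreshuffleHomomorphism Ψ-isHom

      -- On an iterated product of generators the value is forced: each factor is fixed by `φ`, and
      -- `Ψ` respects the products.
      extension-build : ∀ {x xs f} (b : Blocks (x ∷ xs) f) →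
                        Ψ (deg x xs) [ build b ] ≋ evaluate x xs f
      extension-build {d , x} {[]}    (block _ _)           = ≈⇒≋ (Ψ-extends d x)
      extension-build {d , x} {y ∷ ys} (block {i = i} i≤g b) =
        let i≤m = ≤-deg b i≤g in
        ≋-trans (≈⇒≋ (Ψ.homo i≤m [ ξ[ x ] ] [ build b ]))
          (≋-trans (•-cong i≤m i≤m (≈⇒≋ (Ψ-extends d x)) refl (extension-build b))
            (≋-sym (evaluate-block x y ys i≤m i≤g (≋-reflexive refl))))

      extension-unique : EqualMaps K V A Φ Ψ
      extension-unique n = linear-unique K (A n) (Φ-linear n) (Ψ.linear n) agree
        where
        -- Needed because `build b` and `u` lie in degrees that are only propositionally equal.
        Ψ-≋ : ∀ {n m} {x : ∣_∣ K V n} {y : ∣_∣ K V m} → x ≋ᴷ y → Ψ n x ≋ Ψ m y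
        Ψ-≋ {n} (V≋.≈⇒≋ p) = ≈⇒≋ (IsModuleHomomorphism.⟦⟧-cong (Ψ.linear n) p)
        agree : ∀ u → Module._≈ᴹ_ (A n) (onBasis u) (Ψ n [ u ])
        agree u =
          let x , xs , e = labelList-nonempty u
              b = subst (λ zs → Blocks zs (letters u)) e (decompose u)
          in
          ≋⇒≈ (≋-trans (onBasis-evaluate u e refl)
            (≋-trans (≋-sym (extension-build b))
              (Ψ-≋ ([]-≋ (build b) u (trans (labelList-build b) (sym e)) (letters-build b)))))

mainTheorem15 : ∀ {c ℓ₁ ℓ₂ s a ℓa} (K : HeytingField c ℓ₁ ℓ₂) (X : PositivelyGradedSet s) →
    IsPreshuffleAlgebra K (K[𝒦∞] K X) (shuffleOps K X)
    ×
    ((A : PreshuffleAlgebra K a ℓa) →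
    (φ : ∀ n → PositivelyGradedSet.component X n → Module.Carrierᴹ (PreshuffleAlgebra.space A n)) →
    ∃! (EqualMaps K (K[𝒦∞] K X) (PreshuffleAlgebra.space A))
    (λ Φ → IsPreshuffleHomomorphism K (K[𝒦∞] K X) (PreshuffleAlgebra.space A) (shuffleOps K X) (PreshuffleAlgebra.ops A) Φ
    × (∀ n (x : PositivelyGradedSet.component X n) →
    Module._≈ᴹ_ (PreshuffleAlgebra.space A n) (Φ n (generator K X x)) (φ n x))))
mainTheorem15 K X = isPreshuffleAlgebra , λ 𝒜 φ →
  let open Universal 𝒜 φ in
  Φ , (Φ-isHomomorphism , Φ-extends) , λ (Ψ-isHom , Ψ-extends) → extension-unique Ψ-isHom Ψ-extends
  where open FreeAlgebra K X
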